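{- For every DBI normal formula $\varphi$ and every pointed Kripke model $(\mathcal{M},v)$, the pointed update of $(\mathcal{M},v)$ with $(\mathcal{U}_\varphi,0)$ is defined and $\bigl(\mathcal{M}\odot\mathcal{U}_\varphi,(v,0)\bigr)$ is weakly privatized with respect to $\varphi$.
   Context: Agents $\mathcal{A}=\{1,\dots,n\}$, $n>1$; language $\mathcal{L}$: $\varphi ::= p \mid \neg\varphi \mid (\varphi\wedge\varphi)\mid B_i\varphi$, $\top$ the usual tautology. Kripke model $\mathcal{M}=\langle S,R,V\rangle$ (nonempty $S$, $R_i\subseteq S\times S$, $V:\mathit{Prop}\to 2^S$), standard truth. Action model $\mathcal{U}=\langle E,Q,\mathsf{pre}\rangle$ (nonempty $E$, $Q_i\subseteq E\times E$, $\mathsf{pre}:E\to\mathcal{L}$). Frame properties apply to models via their underlying frames. Pointed update of $(\mathcal{M},w)$ with $(\mathcal{U},\alpha)$, defined iff $\mathcal{M},w\vDash\mathsf{pre}(\alpha)$: with $T=\{(x,\beta)\in S\times E\mid\mathcal{M},x\vDash\mathsf{pre}(\beta)\}$, $\mathcal{M}\odot\mathcal{U}=\langle S^{\mathcal U},R^{\mathcal U},V^{\mathcal U}\rangle$ where $S^{\mathcal U}$ is the smallest subset of $T$ containing $(w,\alpha)$ closed under: $(x,\beta)\in S^{\mathcal U}$, $(u,\gamma)\in T$, $xR_iu$, $\beta Q_i\gamma$ imply $(u,\gamma)\in S^{\mathcal U}$; $R^{\mathcal U}_i$ relates $(x,\beta),(u,\gamma)\in S^{\mathcal U}$ iff $xR_iu$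 and $\beta Q_i\gamma$; $V^{\mathcal U}(p)=\{(x,\beta)\in S^{\mathcal U}\mid x\in V(p)\}$. Target agents: $\mathsf{ta}(p)=\varnothing$, $\mathsf{ta}(\neg\phi)=\mathsf{ta}(\phi)$, $\mathsf{ta}(\phi\wedge\psi)=\mathsf{ta}(\phi)\cup\mathsf{ta}(\psi)$, $\mathsf{ta}(B_i\phi)=\{i\}$. DBI formulas: $\varphi ::= B_i\xi \mid B_i(\xi\wedge\varphi)\mid(\varphi\wedge\varphi)\mid B_i\varphi$, $\xi$ purely propositional. DBI normal: $B_i\xi$ always; $B_i\varphi$, $B_i(\xi\wedge\varphi)$ iff $\varphi$ DBI normal and $i\notin\mathsf{ta}(\varphi)$; $\varphi\wedge\psi$ iff both DBI normal and $\mathsf{ta}(\varphi)\cap\mathsf{ta}(\psi)=\varnothing$. Action model $\mathcal{U}_\varphi=\langle E^\varphi,Q^\varphi,\mathsf{pre}^\varphi\rangle$ for DBI normal $\varphi$, recursively; always $E^\varphi=\{0,-1\}\sqcup D^\varphi$, $\varnothing\ne D^\varphi\subseteq\{1,2,\dots\}$, $\mathsf{pre}^\varphi(0)=\mathsf{pre}^\varphi(-1)=\top$; $\underline{Q}_j:=Q_j\cap((E\setminus\{0\})\times(E\setminus\{0\}))$. (1) $\varphi=B_i\xi$: $D=\{m\}$, $\mathsf{pre}(m)=\xi$, $Q_j=\{(0,-1),(m,-1),(-1,-1)\}$ ($j\ne i$), $Q_i=\{(0,m),(m,m),(-1,-1)\}$. (2) $\varphi=B_i\psi$: fresh $m\ge1$,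 $m\notin D^\psi$; $D^\varphi=D^\psi\sqcup\{m\}$; $\mathsf{pre}^\varphi$ extends $\mathsf{pre}^\psi$ with $\mathsf{pre}^\varphi(m)=\top$; $Q^\varphi_j=\underline{Q}^\psi_j\cup\{(0,-1)\}\cup\{(m,k)\mid(0,k)\in Q^\psi_j\}$ ($j\ne i$); $Q^\varphi_i=\underline{Q}^\psi_i\cup\{(0,m),(m,m)\}$. (3) $\varphi=B_i(\xi\wedge\psi)$: as (2) but $\mathsf{pre}^\varphi(m)=\xi$. (4) $\varphi=\psi\wedge\theta$: with $D^\psi\cap D^\theta=\varnothing$, $D^\varphi=D^\psi\sqcup D^\theta$, $\mathsf{pre}^\varphi=\mathsf{pre}^\psi\cup\mathsf{pre}^\theta$, $Q^\varphi_j=\underline{Q}^\psi_j\cup\underline{Q}^\theta_j\cup\{(0,k)\mid(0,k)\in Q^\psi_j\cup Q^\theta_j, k\in D^\psi\sqcup D^\theta\}\cup\{(0,-1)\mid\text{no such }k\text{ exists}\}$. Modal syntactic tree $\mathcal{T}_\varphi$: $\mathcal{T}_{B_i\xi}$ is a root with one child labeled $B_i$; $\mathcal{T}_{B_i\psi}=\mathcal{T}_{B_i(\xi\wedge\psi)}$ is obtained by labeling the root of $\mathcal{T}_\psi$ with $B_i$ and making it the only child of a new unlabeled root; $\mathcal{T}_{\psi\wedge\theta}$ is the disjoint union of $\mathcal{T}_\psi,\mathcal{T}_\theta$ with roots identified. $RootP(\varphi)$: paths from the root (length $\ge0$); $\mathsf{agSeq}(\sigma)$: agents labeling the non-root nodes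 of $\sigma$, in order. Clusters: for a frame $\mathcal{F}=\langle W,R\rangle$, $w\in W$, $C^{i_1,\dots,i_l}_{\mathcal{F},w}=\{u\mid\exists u_2,\dots,u_l:\ wR_{i_1}u_2\cdots u_lR_{i_l}u\}$, $C^\varepsilon_{\mathcal{F},w}=\{w\}$. $\mathcal{A}^l_{\mathrm{nsr}}$: agent sequences of length $l$ without two successive equal agents. $(\mathcal{F},w)$ is weakly privatized w.r.t. $\varphi$ iff for every $\sigma\in RootP(\varphi)$ and every $s\in\bigcup_{l\ge0}\mathcal{A}^l_{\mathrm{nsr}}\setminus\{\mathsf{agSeq}(\sigma)\}$, $C^{\mathsf{agSeq}(\sigma)}_{\mathcal{F},w}\cap C^s_{\mathcal{F},w}=\varnothing$. -}

module Defs where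

open import Data.Empty using (⊥; ⊥-elim)
open import Data.Fin.Base using (Fin)
open import Data.Fin.Subset using (Subset; ⁅_⁆; _∪_) renaming (⊥ to ∅; _∩_ to _∩ₛ_; Empty to Emptyₛ; _∉_ to _∉ₛ_)
open import Data.Irrelevant using ([_])
open import Data.List.Base using (List; []; _∷_; _++_)
open import Data.List.Membership.Propositional using (_∈_)
open import Data.List.Relation.Unary.Linked using (Linked)
open import Data.Maybe.Base using (Maybe; just; nothing)
open import Data.Nat.Base using (ℕ)
open import Data.Product.Base using (∃; _×_; _,_)
open import Data.Refinement.Base using (Refinement-syntax; _,_)
open import Data.Sum.Base using (_⊎_; inj₁; inj₂)
open import Data.Unit.Base using (⊤; tt)
open import Level using (0ℓ)
open import Relation.Binary.Core using (Rel)
open import Relation.Binary.PropositionalEquality.Core using (_≡_; _≢_; refl; cong; cong₂)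
open import Relation.Nullary.Negation.Core using (¬_)
open import Relation.Unary using (Pred; _∩_; Empty)

-- The atom p₀ only serves to write down the tautology ⊤ᶠ.
module EpistemicLogic (n : ℕ) (Atom : Set) (p₀ : Atom) where

  Agent : Set
  Agent = Fin n

  infixr 6 _∧ᶠ_
  infix  7 ¬ᶠ_

  data Formula : Set where
    atom : Atom → Formula
    ¬ᶠ_  : Formula → Formula
    _∧ᶠ_ : Formula → Formula → Formula
    B    : Agent → Formula → Formula

  ⊤ᶠ : Formula
  ⊤ᶠ = ¬ᶠ (atom p₀ ∧ᶠ ¬ᶠ atom p₀)

  record Frame : Set₁ where
    field
      W        : Set
      nonempty : W
      R        : Agent → Rel W 0ℓ

  record KripkeModel : Set₁ where
    field
      frame : Frame
    open Frame frame public
    field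
      V : Atom → Pred W 0ℓ

  open KripkeModel using (frame)

  State : KripkeModel → Set
  State = KripkeModel.W

  infix 4 _,_⊨_

  _,_⊨_ : (M : KripkeModel) → State M → Formula → Set
  M , w ⊨ atom p   = KripkeModel.V M p w
  M , w ⊨ ¬ᶠ φ     = ¬ (M , w ⊨ φ)
  M , w ⊨ (φ ∧ᶠ ψ) = (M , w ⊨ φ) × (M , w ⊨ ψ)
  M , w ⊨ B i φ    = ∀ u → KripkeModel.R M i w u → M , u ⊨ φ

  record ActionModel : Set₁ where
    field
      E        : Set
      nonempty : E
      Q        : Agent → Rel E 0ℓ
      pre      : E → Formula

  module Update (M : KripkeModel) (U : ActionModel) where
    open KripkeModel M
    open ActionModel U using (E; Q; pre)

    T : Pred (W × E) 0ℓ
    T (x , β) = M , x ⊨ pre β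

    data Reachable (w : W) (α : E) : Pred (W × E) 0ℓ where
      start : T (w , α) → Reachable w α (w , α)
      step  : ∀ {i x β u γ} → Reachable w α (x , β) → T (u , γ) →
              R i x u → Q i β γ → Reachable w α (u , γ)

  UpdateDefined : (M : KripkeModel) → State M → (U : ActionModel) → ActionModel.E U → Set
  UpdateDefined M w U α = Update.T M U (w , α)

  module PointedUpdate (M : KripkeModel) (w : State M) (U : ActionModel) (α : ActionModel.E U)
                       (defined : UpdateDefined M w U α) where
    open KripkeModel M using (W; R; V)
    open ActionModel U using (E; Q)
    open Update M U

    -- The membership proof is irrelevant, so that this is a subset of W × E:
    -- two of its elements with the same underlying pair are equal.
    Wᵁ : Set
    Wᵁ = [ xβ ∈ W × E ∣ Reachable w α xβ ]

    Rᵁ : Agent → Rel Wᵁ 0ℓ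
    Rᵁ i ((x , β) , _) ((u , γ) , _) = R i x u × Q i β γ

    point : Wᵁ
    point = (w , α) , [ start defined ]

    model : KripkeModel
    model = record
      { frame = record { W = Wᵁ ; nonempty = point ; R = Rᵁ }
      ; V     = λ { p ((x , _) , _) → V p x }
      }

  ta : Formula → Subset n
  ta (atom p)  = ∅
  ta (¬ᶠ φ)    = ta φ
  ta (φ ∧ᶠ ψ)  = ta φ ∪ ta ψ
  ta (B i φ)   = ⁅ i ⁆

  data Propositional : Formula → Set where
    atom : ∀ p → Propositional (atom p)
    ¬ᶠ_  : ∀ {ξ} → Propositional ξ → Propositional (¬ᶠ ξ)
    _∧ᶠ_ : ∀ {ξ ζ} → Propositional ξ → Propositional ζ → Propositional (ξ ∧ᶠ ζ)

  data DBI : Formula → Set where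
    believesProp : ∀ i {ξ} → Propositional ξ → DBI (B i ξ)
    believes     : ∀ i {φ} → DBI φ → DBI (B i φ)
    believesBoth : ∀ i {ξ φ} → Propositional ξ → DBI φ → DBI (B i (ξ ∧ᶠ φ))
    _∧ᶠ_         : ∀ {φ ψ} → DBI φ → DBI ψ → DBI (φ ∧ᶠ ψ)

  -- Recursion over DBI derivations below amounts to recursion over DBI
  -- formulas, because the grammar is unambiguous.

  ¬PropositionalDBI : ∀ {φ} → Propositional φ → DBI φ → ⊥
  ¬PropositionalDBI (p ∧ᶠ _) (d ∧ᶠ _) = ¬PropositionalDBI p d

  Propositional-unique : ∀ {φ} (p q : Propositional φ) → p ≡ q
  Propositional-unique (atom p)   (atom .p)    = refl
  Propositional-unique (¬ᶠ p)     (¬ᶠ q)       = cong ¬ᶠ_ (Propositional-unique p q)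
  Propositional-unique (p ∧ᶠ p′)  (q ∧ᶠ q′)    =
    cong₂ _∧ᶠ_ (Propositional-unique p q) (Propositional-unique p′ q′)

  DBI-unique : ∀ {φ} (d e : DBI φ) → d ≡ e
  DBI-unique (believesProp i p) (believesProp .i q) =
    cong (believesProp i) (Propositional-unique p q)
  DBI-unique (believesProp i p) (believes .i e) = ⊥-elim (¬PropositionalDBI p e)
  DBI-unique (believesProp i (_ ∧ᶠ p)) (believesBoth .i _ e) = ⊥-elim (¬PropositionalDBI p e)
  DBI-unique (believes i d) (believesProp .i q) = ⊥-elim (¬PropositionalDBI q d)
  DBI-unique (believes i d) (believes .i e) = cong (believes i) (DBI-unique d e)
  DBI-unique (believes i (d ∧ᶠ _)) (believesBoth .i q _) = ⊥-elim (¬PropositionalDBI q d)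
  DBI-unique (believesBoth i _ d) (believesProp .i (_ ∧ᶠ q)) = ⊥-elim (¬PropositionalDBI q d)
  DBI-unique (believesBoth i p _) (believes .i (e ∧ᶠ _)) = ⊥-elim (¬PropositionalDBI p e)
  DBI-unique (believesBoth i p d) (believesBoth .i q e) =
    cong₂ (believesBoth i) (Propositional-unique p q) (DBI-unique d e)
  DBI-unique (d ∧ᶠ d′) (e ∧ᶠ e′) = cong₂ _∧ᶠ_ (DBI-unique d e) (DBI-unique d′ e′)

  Normal : ∀ {φ} → DBI φ → Set
  Normal (believesProp i _)              = ⊤
  Normal (believes i {φ} d)              = Normal d × i ∉ₛ ta φ
  Normal (believesBoth i {φ = φ} _ d)    = Normal d × i ∉ₛ ta φ
  Normal (_∧ᶠ_ {φ} {ψ} d e)              = Normal d × Normal e × Emptyₛ (ta φ ∩ₛ ta ψ)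

  -- {0, -1} ⊔ D
  data Event (D : Set) : Set where
    𝟎  : Event D
    -𝟏 : Event D
    ev : D → Event D

  mapEvent : ∀ {D D′ : Set} → (D → D′) → Event D → Event D′
  mapEvent f 𝟎      = 𝟎
  mapEvent f -𝟏     = -𝟏
  mapEvent f (ev k) = ev (f k)

  EventRel : Set → Set₁
  EventRel D = Agent → Rel (Event D) 0ℓ

  -- The relation  Q̲ⱼ  renamed along the inclusion f of D in a larger set of
  -- labels.  The equations keep mapEvent out of the indices.
  record Underlined {D D′ : Set} (f : D → D′) (Q : EventRel D)
                    (j : Agent) (β′ γ′ : Event D′) : Set where
    constructor underlined
    field
      {β γ}   : Event D
      edge    : Q j β γ
      β≢𝟎     : β ≢ 𝟎
      γ≢𝟎     : γ ≢ 𝟎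
      β-image : β′ ≡ mapEvent f β
      γ-image : γ′ ≡ mapEvent f γ

  -- m is the only element of D, namely tt.
  data QProp (i : Agent) : EventRel ⊤ where
    other-𝟎  : ∀ {j} → j ≢ i → QProp i j 𝟎 -𝟏
    other-m  : ∀ {j} → j ≢ i → QProp i j (ev tt) -𝟏
    other-𝟏  : ∀ {j} → j ≢ i → QProp i j -𝟏 -𝟏
    own-𝟎    : QProp i i 𝟎 (ev tt)
    own-m    : QProp i i (ev tt) (ev tt)
    own-𝟏    : QProp i i -𝟏 -𝟏

  -- The fresh m is nothing : Maybe D.  The k with (0 , k) ∈ Qψ is an
  -- arbitrary event, possibly -1.
  data QBelieves (i : Agent) {D : Set} (Qψ : EventRel D) : EventRel (Maybe D) where
    old     : ∀ {j β γ} → Underlined just Qψ j β γ → QBelieves i Qψ j β γ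
    other-𝟎 : ∀ {j} → j ≢ i → QBelieves i Qψ j 𝟎 -𝟏
    other-m : ∀ {j k k′} → j ≢ i → Qψ j 𝟎 k → k′ ≡ mapEvent just k →
              QBelieves i Qψ j (ev nothing) k′
    own-𝟎   : QBelieves i Qψ i 𝟎 (ev nothing)
    own-m   : QBelieves i Qψ i (ev nothing) (ev nothing)

  data QAnd {D D′ : Set} (Qψ : EventRel D) (Qθ : EventRel D′) : EventRel (D ⊎ D′) where
    oldˡ  : ∀ {j β γ} → Underlined inj₁ Qψ j β γ → QAnd Qψ Qθ j β γ
    oldʳ  : ∀ {j β γ} → Underlined inj₂ Qθ j β γ → QAnd Qψ Qθ j β γ
    rootˡ : ∀ {j k} → Qψ j 𝟎 (ev k) → QAnd Qψ Qθ j 𝟎 (ev (inj₁ k))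
    rootʳ : ∀ {j k} → Qθ j 𝟎 (ev k) → QAnd Qψ Qθ j 𝟎 (ev (inj₂ k))
    sink  : ∀ {j} → ¬ (∃ λ k → Qψ j 𝟎 (ev k)) → ¬ (∃ λ k → Qθ j 𝟎 (ev k)) →
            QAnd Qψ Qθ j 𝟎 -𝟏

  -- Instead of fresh numbers for the events of U d, sum types provide
  -- freshness of m and disjointness in the conjunctive case.
  D : ∀ {φ} → DBI φ → Set
  D (believesProp i _)   = ⊤
  D (believes i d)       = Maybe (D d)
  D (believesBoth i _ d) = Maybe (D d)
  D (d ∧ᶠ e)             = D d ⊎ D e

  preD : ∀ {φ} (d : DBI φ) → D d → Formula
  preD (believesProp i {ξ} _)   _        = ξ
  preD (believes i d)           nothing  = ⊤ᶠ
  preD (believes i d)           (just k) = preD d k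
  preD (believesBoth i {ξ} _ d) nothing  = ξ
  preD (believesBoth i _ d)     (just k) = preD d k
  preD (d ∧ᶠ e)                 (inj₁ k) = preD d k
  preD (d ∧ᶠ e)                 (inj₂ k) = preD e k

  preE : ∀ {φ} (d : DBI φ) → Event (D d) → Formula
  preE d 𝟎      = ⊤ᶠ
  preE d -𝟏     = ⊤ᶠ
  preE d (ev k) = preD d k

  QE : ∀ {φ} (d : DBI φ) → EventRel (D d)
  QE (believesProp i _)   = QProp i
  QE (believes i d)       = QBelieves i (QE d)
  QE (believesBoth i _ d) = QBelieves i (QE d)
  QE (d ∧ᶠ e)             = QAnd (QE d) (QE e)

  U : ∀ {φ} → DBI φ → ActionModel
  U d = record { E = Event (D d) ; nonempty = 𝟎 ; Q = QE d ; pre = preE d }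

  -- The root of a tree carries no label; every other node is stored,
  -- together with its label, among the children of its parent.
  data Tree : Set where
    node : List (Agent × Tree) → Tree

  joinRoots : Tree → Tree → Tree
  joinRoots (node ts) (node us) = node (ts ++ us)

  tree : ∀ {φ} → DBI φ → Tree
  tree (believesProp i _)   = node ((i , node []) ∷ [])
  tree (believes i d)       = node ((i , tree d) ∷ [])
  tree (believesBoth i _ d) = node ((i , tree d) ∷ [])
  tree (d ∧ᶠ e)             = joinRoots (tree d) (tree e)

  data RootPath : Tree → Set where
    root : ∀ {ts} → RootPath (node ts)
    down : ∀ {ts i t} → (i , t) ∈ ts → RootPath t → RootPath (node ts)

  RootP : ∀ {φ} → DBI φ → Set
  RootP d = RootPath (tree d)

  agSeq : ∀ {t} → RootPath t → List Agent
  agSeq root               = []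
  agSeq (down {i = i} _ σ) = i ∷ agSeq σ

  Cluster : (F : Frame) → Frame.W F → List Agent → Pred (Frame.W F) 0ℓ
  Cluster F w []      u = w ≡ u
  Cluster F w (i ∷ s) u = ∃ λ w′ → Frame.R F i w w′ × Cluster F w′ s u

  NoSuccessiveRepetition : List Agent → Set
  NoSuccessiveRepetition = Linked _≢_

  WeaklyPrivatized : ∀ {φ} → DBI φ → (F : Frame) → Frame.W F → Set
  WeaklyPrivatized d F w =
    ∀ (σ : RootP d) (s : List Agent) → NoSuccessiveRepetition s → s ≢ agSeq σ →
    Empty (Cluster F w (agSeq σ) ∩ Cluster F w s)

{-# OPTIONS --safe #-}
module Submission where

open import Defs
open import Data.Nat using (ℕ; _>_)
open import Data.Product using (Σ-syntax)
open import Data.Fin.Subset using (_∈_)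
open import Data.Fin.Subset.Properties using (x∈⁅x⁆; x∈⁅y⁆⇒x≡y; x∈p∪q⁻; x∈p∪q⁺; x∈p∩q⁺)
open import Data.List.Base using (List; []; _∷_; _++_; _∷ʳ_)
open import Data.List.Membership.Propositional.Properties using (∈-++⁻)
open import Data.List.Properties using (++-identityʳ; ∷-injectiveʳ; ∷ʳ-++)
open import Data.List.Relation.Unary.Any using (here)
open import Data.List.Relation.Unary.Linked as Linked using (Linked; []; [-]; _∷_)
open import Data.Maybe.Base using (Maybe; just; nothing; maybe)
open import Data.Product.Base using (∃; ∃₂; _×_; _,_; proj₂)
open import Data.Refinement.Base using (value)
open import Data.Sum.Base as Sum using (_⊎_; inj₁; inj₂; [_,_])
open import Function.Base using (const)
open import Relation.Binary.PropositionalEquality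
  using (_≡_; _≢_; refl; sym; trans; cong; subst)
open import Relation.Nullary.Negation using (¬_; contradiction)

-- Every event k of D has an address: the agents read on the way to the node
-- of the modal tree that created k.  An edge of U between events of D either
-- prolongs the address by its agent or is a loop whose agent is the last one
-- of the address.  A path from 𝟎 without successive repetitions never uses a
-- loop, so its sequence is the address of its end point.  By normality, the
-- sequence of a root path is free of successive repetitions and never leads
-- to the sink -𝟏, where different sequences do meet.

-- Lists without successive repetitions

module _ {A : Set} where

  []≢xs++y∷ys : ∀ (xs : List A) {y ys} → [] ≢ xs ++ y ∷ ys
  []≢xs++y∷ys []      ()
  []≢xs++y∷ys (_ ∷ _) ()

  Linked-≢⇒¬repetition : ∀ (xs : List A) {y ys} → ¬ Linked _≢_ (xs ++ y ∷ y ∷ ys)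
  Linked-≢⇒¬repetition []       (y≢y ∷ _) = y≢y refl
  Linked-≢⇒¬repetition (x ∷ xs) l         = Linked-≢⇒¬repetition xs (Linked.tail l)

  -- The condition on the head is guarded by an equation, so it is vacuous for the empty list and
  -- callers need no case distinction.
  Linked-∷ : ∀ {x : A} {xs} → (∀ {y ys} → xs ≡ y ∷ ys → x ≢ y) →
             Linked _≢_ xs → Linked _≢_ (x ∷ xs)
  Linked-∷ x≢ []      = [-]
  Linked-∷ x≢ [-]     = x≢ refl ∷ [-]
  Linked-∷ x≢ (p ∷ l) = x≢ refl ∷ p ∷ l

module Addresses (n : ℕ) (Atom : Set) (p₀ : Atom) where
  open EpistemicLogic n Atom p₀

  -- Addressed relations and their clusters at `𝟎`

  eventFrame : ∀ {D} → EventRel D → Frame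
  eventFrame {D} Q = record { W = Event D ; nonempty = 𝟎 ; R = Q }

  -- Edges into `-𝟏` are left free here: whether they do harm depends on the sequence being read, so
  -- they are left to `AvoidsSink`.
  record Addressed {D : Set} (Q : EventRel D) (addr : D → List Agent) : Set where
    field
      into-𝟎  : ∀ {j β} → ¬ Q j β 𝟎
      from-𝟏  : ∀ {j k} → ¬ Q j -𝟏 (ev k)
      from-𝟎  : ∀ {j k} → Q j 𝟎 (ev k) → addr k ≡ j ∷ []
      from-ev : ∀ {j k l} → Q j (ev k) (ev l) →
                addr l ≡ addr k ∷ʳ j ⊎ (k ≡ l × ∃ λ xs → addr k ≡ xs ∷ʳ j)

  -- Only the events whose address is a proper prefix of s are constrained, and
  -- only for the agent that s reads next.
  record AvoidsSink {D : Set} (Q : EventRel D) (addr : D → List Agent)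
                    (s : List Agent) : Set where
    field
      at-𝟎  : ∀ {j r} → s ≡ j ∷ r → ¬ Q j 𝟎 -𝟏
      at-ev : ∀ {j r} k → s ≡ addr k ++ j ∷ r → ¬ Q j (ev k) -𝟏

  open Addressed
  open AvoidsSink

  avoidsSink-[] : ∀ {D} {Q : EventRel D} {addr} → AvoidsSink Q addr []
  avoidsSink-[]               .at-𝟎  ()
  avoidsSink-[] {addr = addr} .at-ev k eq _ = []≢xs++y∷ys (addr k) eq

  module _ {D : Set} {Q : EventRel D} {addr : D → List Agent} (A : Addressed Q addr) where

    private
      F : Frame
      F = eventFrame Q

    cluster-𝟎⇒[] : ∀ {β} s → Cluster F β s 𝟎 → s ≡ []
    cluster-𝟎⇒[] []          _               = refl
    cluster-𝟎⇒[] (j ∷ [])    (.𝟎 , q , refl) = contradiction q (into-𝟎 A)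
    cluster-𝟎⇒[] (j ∷ i ∷ s) (_ , _ , c)     with () ← cluster-𝟎⇒[] (i ∷ s) c

    -𝟏-absorbing : ∀ {k} s → ¬ Cluster F -𝟏 s (ev k)
    -𝟏-absorbing []      ()
    -𝟏-absorbing (j ∷ s) (𝟎    , q , _) = into-𝟎 A q
    -𝟏-absorbing (j ∷ s) (-𝟏   , _ , c) = -𝟏-absorbing s c
    -𝟏-absorbing (j ∷ s) (ev k , q , _) = from-𝟏 A q

    -- The agent of a loop at `ev l` is the last one of `addr l`, so reading it next would repeat
    -- it.
    ¬loop : ∀ {l j s} → NoSuccessiveRepetition (addr l ++ j ∷ s) →
            ¬ ∃ λ xs → addr l ≡ xs ∷ʳ j
    ¬loop {j = j} {s} nsr (xs , eq) = Linked-≢⇒¬repetition xs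
      (subst NoSuccessiveRepetition (trans (cong (_++ j ∷ s) eq) (∷ʳ-++ xs j (j ∷ s))) nsr)

    address-++ : ∀ {k l j} s → addr k ≡ addr l ∷ʳ j → addr k ++ s ≡ addr l ++ j ∷ s
    address-++ {l = l} {j} s eq = trans (cong (_++ s) eq) (∷ʳ-++ (addr l) j s)

    -- The hypothesis concerns `addr l ++ s`, because the last agent of the address decides whether
    -- the first edge may be a loop. A prolonging edge shifts `j` from the sequence to the address
    -- and leaves the whole list unchanged.
    address-end-ev : ∀ {l k} s → NoSuccessiveRepetition (addr l ++ s) →
                     Cluster F (ev l) s (ev k) → addr l ++ s ≡ addr k
    address-end-ev {l} []  _   refl           = ++-identityʳ (addr l)
    address-end-ev (j ∷ s) nsr (𝟎    , q , _) = contradiction q (into-𝟎 A)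
    address-end-ev (j ∷ s) nsr (-𝟏   , _ , c) = contradiction c (-𝟏-absorbing s)
    address-end-ev (j ∷ s) nsr (ev m , q , c) with from-ev A q
    ... | inj₁ eq = trans (sym e) (address-end-ev s (subst NoSuccessiveRepetition (sym e) nsr) c)
      where e = address-++ s eq
    ... | inj₂ (refl , loop) = contradiction loop (¬loop nsr)

    address-end : ∀ {k} s → NoSuccessiveRepetition s → Cluster F 𝟎 s (ev k) → s ≡ addr k
    address-end []      nsr ()
    address-end (j ∷ s) nsr (𝟎    , q , _) = contradiction q (into-𝟎 A)
    address-end (j ∷ s) nsr (-𝟏   , _ , c) = contradiction c (-𝟏-absorbing s)
    address-end (j ∷ s) nsr (ev m , q , c) =
      trans (sym e) (address-end-ev s (subst NoSuccessiveRepetition (sym e) nsr) c)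
      where e = cong (_++ s) (from-𝟎 A q)

    -- `t` stays fixed in the induction while `s` shrinks, because `AvoidsSink` speaks of positions
    -- in the whole sequence.
    avoids-ev : ∀ {l t} s → t ≡ addr l ++ s → AvoidsSink Q addr t →
                NoSuccessiveRepetition t → ¬ Cluster F (ev l) s -𝟏
    avoids-ev []      _  _  _   ()
    avoids-ev (j ∷ s) _  _  _   (𝟎    , q , _) = into-𝟎 A q
    avoids-ev (j ∷ s) eq av _   (-𝟏   , q , _) = at-ev av _ eq q
    avoids-ev (j ∷ s) eq av nsr (ev m , q , c) with from-ev A q
    ... | inj₁ e = avoids-ev s (trans eq (sym (address-++ s e))) av nsr c
    ... | inj₂ (refl , loop) = ¬loop (subst NoSuccessiveRepetition eq nsr) loop

    avoids : ∀ s → AvoidsSink Q addr s → NoSuccessiveRepetition s → ¬ Cluster F 𝟎 s -𝟏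
    avoids []      _  _   ()
    avoids (j ∷ s) _  _   (𝟎    , q , _) = into-𝟎 A q
    avoids (j ∷ s) av _   (-𝟏   , q , _) = at-𝟎 av refl q
    avoids (j ∷ s) av nsr (ev m , q , c) =
      avoids-ev s (sym (cong (_++ s) (from-𝟎 A q))) av nsr c

    -- `avoids` for `s` alone excludes the end point `-𝟏`, so `t` need not come from a root path.
    -- This matches the asymmetry of weak privatization.
    cluster-unique : ∀ {γ s t} → AvoidsSink Q addr s →
                     NoSuccessiveRepetition s → NoSuccessiveRepetition t →
                     Cluster F 𝟎 s γ → Cluster F 𝟎 t γ → s ≡ t
    cluster-unique {𝟎}    {s} {t} _  _    _    c c′ =
      trans (cluster-𝟎⇒[] s c) (sym (cluster-𝟎⇒[] t c′))
    cluster-unique { -𝟏}  {s} {t} av nsr  _    c _  = contradiction c (avoids s av nsr)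
    cluster-unique {ev k} {s} {t} _  nsr  nsr′ c c′ =
      trans (address-end s nsr c) (sym (address-end t nsr′ c′))

  -- The relations `QProp`, `QBelieves` and `QAnd`

  module _ {i : Agent} where

    QProp-addressed : Addressed (QProp i) (const (i ∷ []))
    QProp-addressed .into-𝟎  ()
    QProp-addressed .from-𝟏  ()
    QProp-addressed .from-𝟎  own-𝟎 = refl
    QProp-addressed .from-ev own-m = inj₂ (refl , [] , refl)

    QProp-avoidsSink : AvoidsSink (QProp i) (const (i ∷ [])) (i ∷ [])
    QProp-avoidsSink .at-𝟎  refl (other-𝟎 i≢i) = i≢i refl
    QProp-avoidsSink .at-ev k    ()

  module _ {i : Agent} {D : Set} {Q : EventRel D} {addr : D → List Agent} where

    private
      addr′ : Maybe D → List Agent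
      addr′ = maybe (λ k → i ∷ addr k) (i ∷ [])

    -- The fresh event inherits the edges of the old `𝟎`, so the old `from-𝟎` becomes an instance of
    -- `from-ev`, with old addresses prefixed by `i`.
    QBelieves-addressed : Addressed Q addr → Addressed (QBelieves i Q) addr′
    QBelieves-addressed A .into-𝟎 (old (underlined {γ = 𝟎} _ _ γ≢𝟎 _ _)) = γ≢𝟎 refl
    QBelieves-addressed A .into-𝟎 (other-m {k = 𝟎} _ q _) = into-𝟎 A q
    QBelieves-addressed A .from-𝟏 (old (underlined {β = -𝟏} {γ = ev _} q _ _ _ _)) =
      from-𝟏 A q
    QBelieves-addressed A .from-𝟎 (old (underlined {β = 𝟎} _ β≢𝟎 _ _ _)) =
      contradiction refl β≢𝟎
    QBelieves-addressed A .from-𝟎 own-𝟎 = refl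
    QBelieves-addressed A .from-ev (old (underlined {β = ev _} {γ = ev _} q _ _ refl refl)) =
      Sum.map (cong (i ∷_))
              (λ { (refl , xs , eq) → refl , i ∷ xs , cong (i ∷_) eq })
              (from-ev A q)
    QBelieves-addressed A .from-ev (other-m {k = ev _} _ q refl) =
      inj₁ (cong (i ∷_) (from-𝟎 A q))
    QBelieves-addressed A .from-ev own-m = inj₂ (refl , [] , refl)

    -- Reading `i` leads from `𝟎` to the fresh event, where the old `at-𝟎` applies to the rest `s`;
    -- at older events the old `at-ev` does.
    QBelieves-avoidsSink : ∀ {s} → AvoidsSink Q addr s →
                           AvoidsSink (QBelieves i Q) addr′ (i ∷ s)
    QBelieves-avoidsSink av .at-𝟎 _    (old (underlined {β = 𝟎} _ β≢𝟎 _ _ _)) = β≢𝟎 refl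
    QBelieves-avoidsSink av .at-𝟎 refl (other-𝟎 i≢i) = i≢i refl
    QBelieves-avoidsSink av .at-ev nothing eq (old (underlined {β = ev _} _ _ _ () _))
    QBelieves-avoidsSink av .at-ev nothing eq (other-m {k = -𝟏} _ q _) =
      at-𝟎 av (∷-injectiveʳ eq) q
    QBelieves-avoidsSink av .at-ev (just k) eq
      (old (underlined {β = ev _} {γ = -𝟏} q _ _ refl _)) = at-ev av k (∷-injectiveʳ eq) q

  module _ {D D′ : Set} {Qψ : EventRel D} {Qθ : EventRel D′}
           {addrψ : D → List Agent} {addrθ : D′ → List Agent} where

    QAnd-addressed : Addressed Qψ addrψ → Addressed Qθ addrθ →
                     Addressed (QAnd Qψ Qθ) [ addrψ , addrθ ]
    QAnd-addressed A A′ .into-𝟎 (oldˡ (underlined {γ = 𝟎} _ _ γ≢𝟎 _ _)) = γ≢𝟎 refl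
    QAnd-addressed A A′ .into-𝟎 (oldʳ (underlined {γ = 𝟎} _ _ γ≢𝟎 _ _)) = γ≢𝟎 refl
    QAnd-addressed A A′ .from-𝟏 (oldˡ (underlined {β = -𝟏} {γ = ev _} q _ _ _ _)) =
      from-𝟏 A q
    QAnd-addressed A A′ .from-𝟏 (oldʳ (underlined {β = -𝟏} {γ = ev _} q _ _ _ _)) =
      from-𝟏 A′ q
    QAnd-addressed A A′ .from-𝟎 (oldˡ (underlined {β = 𝟎} _ β≢𝟎 _ _ _)) =
      contradiction refl β≢𝟎
    QAnd-addressed A A′ .from-𝟎 (oldʳ (underlined {β = 𝟎} _ β≢𝟎 _ _ _)) =
      contradiction refl β≢𝟎
    QAnd-addressed A A′ .from-𝟎 (rootˡ q) = from-𝟎 A q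
    QAnd-addressed A A′ .from-𝟎 (rootʳ q) = from-𝟎 A′ q
    QAnd-addressed A A′ .from-ev
      (oldˡ (underlined {β = ev _} {γ = ev _} q _ _ refl refl)) =
      Sum.map₂ (λ { (refl , loop) → refl , loop }) (from-ev A q)
    QAnd-addressed A A′ .from-ev
      (oldʳ (underlined {β = ev _} {γ = ev _} q _ _ refl refl)) =
      Sum.map₂ (λ { (refl , loop) → refl , loop }) (from-ev A′ q)

    -- The edge required for the first agent of `s` blocks `sink`. Since no address from the right
    -- conjunct is a prefix of `s`, `at-ev` is vacuous at the events of that conjunct.
    QAnd-avoidsSinkˡ : ∀ {s} → AvoidsSink Qψ addrψ s →
                       (∀ {j r} → s ≡ j ∷ r → ∃ λ k → Qψ j 𝟎 (ev k)) →
                       (∀ k {r} → s ≢ addrθ k ++ r) →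
                       AvoidsSink (QAnd Qψ Qθ) [ addrψ , addrθ ] s
    QAnd-avoidsSinkˡ av edge s≢ .at-𝟎 _ (oldˡ (underlined {β = 𝟎} _ β≢𝟎 _ _ _)) = β≢𝟎 refl
    QAnd-avoidsSinkˡ av edge s≢ .at-𝟎 _ (oldʳ (underlined {β = 𝟎} _ β≢𝟎 _ _ _)) = β≢𝟎 refl
    QAnd-avoidsSinkˡ av edge s≢ .at-𝟎 eq (sink ¬k _) = ¬k (edge eq)
    QAnd-avoidsSinkˡ av edge s≢ .at-ev (inj₁ k) eq
      (oldˡ (underlined {β = ev _} {γ = -𝟏} q _ _ refl _)) = at-ev av k eq q
    QAnd-avoidsSinkˡ av edge s≢ .at-ev (inj₁ k) eq
      (oldʳ (underlined {β = ev _} _ _ _ () _))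
    QAnd-avoidsSinkˡ av edge s≢ .at-ev (inj₂ k) eq _ = s≢ k eq

    QAnd-avoidsSinkʳ : ∀ {s} → AvoidsSink Qθ addrθ s →
                       (∀ {j r} → s ≡ j ∷ r → ∃ λ k → Qθ j 𝟎 (ev k)) →
                       (∀ k {r} → s ≢ addrψ k ++ r) →
                       AvoidsSink (QAnd Qψ Qθ) [ addrψ , addrθ ] s
    QAnd-avoidsSinkʳ av edge s≢ .at-𝟎 _ (oldˡ (underlined {β = 𝟎} _ β≢𝟎 _ _ _)) = β≢𝟎 refl
    QAnd-avoidsSinkʳ av edge s≢ .at-𝟎 _ (oldʳ (underlined {β = 𝟎} _ β≢𝟎 _ _ _)) = β≢𝟎 refl
    QAnd-avoidsSinkʳ av edge s≢ .at-𝟎 eq (sink _ ¬k) = ¬k (edge eq)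
    QAnd-avoidsSinkʳ av edge s≢ .at-ev (inj₂ k) eq
      (oldʳ (underlined {β = ev _} {γ = -𝟏} q _ _ refl _)) = at-ev av k eq q
    QAnd-avoidsSinkʳ av edge s≢ .at-ev (inj₂ k) eq
      (oldˡ (underlined {β = ev _} _ _ _ () _))
    QAnd-avoidsSinkʳ av edge s≢ .at-ev (inj₁ k) eq _ = s≢ k eq

  -- Addresses and root sequences of DBI formulas

  address : ∀ {φ} (d : DBI φ) → D d → List Agent
  address (believesProp i _)   = const (i ∷ [])
  address (believes i d)       = maybe (λ k → i ∷ address d k) (i ∷ [])
  address (believesBoth i _ d) = maybe (λ k → i ∷ address d k) (i ∷ [])
  address (d ∧ᶠ e)             = [ address d , address e ]

  QE-addressed : ∀ {φ} (d : DBI φ) → Addressed (QE d) (address d)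
  QE-addressed (believesProp i _)   = QProp-addressed
  QE-addressed (believes i d)       = QBelieves-addressed (QE-addressed d)
  QE-addressed (believesBoth i _ d) = QBelieves-addressed (QE-addressed d)
  QE-addressed (d ∧ᶠ e)             = QAnd-addressed (QE-addressed d) (QE-addressed e)

  -- This ties addresses to target agents, so that disjoint target agents can separate the two sides
  -- of a conjunction.
  address-head : ∀ {φ} (d : DBI φ) k → ∃₂ λ j r → address d k ≡ j ∷ r × j ∈ ta φ
  address-head (believesProp i _)   _        = i , _ , refl , x∈⁅x⁆ i
  address-head (believes i d)       nothing  = i , _ , refl , x∈⁅x⁆ i
  address-head (believes i d)       (just k) = i , _ , refl , x∈⁅x⁆ i
  address-head (believesBoth i _ d) nothing  = i , _ , refl , x∈⁅x⁆ i
  address-head (believesBoth i _ d) (just k) = i , _ , refl , x∈⁅x⁆ i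
  address-head (d ∧ᶠ e) (inj₁ k) with j , r , eq , j∈ ← address-head d k =
    j , r , eq , x∈p∪q⁺ (inj₁ j∈)
  address-head (d ∧ᶠ e) (inj₂ k) with j , r , eq , j∈ ← address-head e k =
    j , r , eq , x∈p∪q⁺ (inj₂ j∈)

  -- Supplies the edge that blocks `sink` for the target agents of a conjunct.
  ta-edge : ∀ {φ} (d : DBI φ) {j} → j ∈ ta φ → ∃ λ k → QE d j 𝟎 (ev k)
  ta-edge (believesProp i _)   j∈ with refl ← x∈⁅y⁆⇒x≡y i j∈ = _ , own-𝟎
  ta-edge (believes i d)       j∈ with refl ← x∈⁅y⁆⇒x≡y i j∈ = _ , own-𝟎
  ta-edge (believesBoth i _ d) j∈ with refl ← x∈⁅y⁆⇒x≡y i j∈ = _ , own-𝟎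
  ta-edge (_∧ᶠ_ {φ} {ψ} d e)   j∈ with x∈p∪q⁻ (ta φ) (ta ψ) j∈
  ... | inj₁ j∈φ = _ , rootˡ (proj₂ (ta-edge d j∈φ))
  ... | inj₂ j∈ψ = _ , rootʳ (proj₂ (ta-edge e j∈ψ))

  -- A path changes its type when trees are joined, but its agent sequence stays the same; hence the
  -- inductions run over sequences.
  IsRootSeq : Tree → List Agent → Set
  IsRootSeq t s = ∃ λ (σ : RootPath t) → agSeq σ ≡ s

  joinRoots-rootSeq : ∀ t u {s} → IsRootSeq (joinRoots t u) s → IsRootSeq t s ⊎ IsRootSeq u s
  -- The path of length 0 lies in both trees; the left one is chosen.
  joinRoots-rootSeq (node ts) (node us) (root , eq) = inj₁ (root , eq)
  joinRoots-rootSeq (node ts) (node us) (down t∈ σ , eq) =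
    Sum.map (λ t∈ → down t∈ σ , eq) (λ t∈ → down t∈ σ , eq) (∈-++⁻ ts t∈)

  rootSeq-head : ∀ {φ} (d : DBI φ) {j r} → IsRootSeq (tree d) (j ∷ r) → j ∈ ta φ
  rootSeq-head (believesProp i _)   (down (here refl) _ , refl) = x∈⁅x⁆ i
  rootSeq-head (believes i d)       (down (here refl) _ , refl) = x∈⁅x⁆ i
  rootSeq-head (believesBoth i _ d) (down (here refl) _ , refl) = x∈⁅x⁆ i
  rootSeq-head (d ∧ᶠ e) σ = x∈p∪q⁺
    (Sum.map (rootSeq-head d) (rootSeq-head e) (joinRoots-rootSeq (tree d) (tree e) σ))

  -- A repetition could arise only where `i` is put before a sequence starting with `i`; then `i`
  -- would be a target agent of the formula below, against normality.
  rootSeq-nsr : ∀ {φ} (d : DBI φ) → Normal d → ∀ {s} → IsRootSeq (tree d) s →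
                NoSuccessiveRepetition s
  rootSeq-nsr (believesProp i _) _ (root , refl) = []
  rootSeq-nsr (believesProp i _) _ (down (here refl) root , refl) = [-]
  rootSeq-nsr (believes i d) _ (root , refl) = []
  rootSeq-nsr (believes i d) (nd , i∉) (down (here refl) σ , refl) =
    Linked-∷ (λ { eq refl → i∉ (rootSeq-head d (σ , eq)) }) (rootSeq-nsr d nd (σ , refl))
  rootSeq-nsr (believesBoth i _ d) _ (root , refl) = []
  rootSeq-nsr (believesBoth i _ d) (nd , i∉) (down (here refl) σ , refl) =
    Linked-∷ (λ { eq refl → i∉ (rootSeq-head d (σ , eq)) }) (rootSeq-nsr d nd (σ , refl))
  rootSeq-nsr (d ∧ᶠ e) (nd , ne , _) σ =
    [ rootSeq-nsr d nd , rootSeq-nsr e ne ] (joinRoots-rootSeq (tree d) (tree e) σ)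

  rootSeq-address : ∀ {φ ψ} (d : DBI φ) (e : DBI ψ) → (∀ {j} → j ∈ ta φ → ¬ j ∈ ta ψ) →
                    ∀ {s} → IsRootSeq (tree d) s → ∀ k {r} → s ≢ address e k ++ r
  rootSeq-address d e disjoint σ k {r} refl with address e k | address-head e k
  ... | _ | j , _ , refl , j∈ = disjoint (rootSeq-head d σ) j∈

  -- At a conjunction, normality makes the target agents disjoint, which keeps a root sequence of
  -- one conjunct away from the events of the other.
  rootSeq-avoidsSink : ∀ {φ} (d : DBI φ) → Normal d → ∀ {s} → IsRootSeq (tree d) s →
                       AvoidsSink (QE d) (address d) s
  rootSeq-avoidsSink (believesProp i _) _ (root , refl) = avoidsSink-[]
  rootSeq-avoidsSink (believesProp i _) _ (down (here refl) root , refl) = QProp-avoidsSink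
  rootSeq-avoidsSink (believes i d) _ (root , refl) = avoidsSink-[]
  rootSeq-avoidsSink (believes i d) (nd , _) (down (here refl) σ , refl) =
    QBelieves-avoidsSink (rootSeq-avoidsSink d nd (σ , refl))
  rootSeq-avoidsSink (believesBoth i _ d) _ (root , refl) = avoidsSink-[]
  rootSeq-avoidsSink (believesBoth i _ d) (nd , _) (down (here refl) σ , refl) =
    QBelieves-avoidsSink (rootSeq-avoidsSink d nd (σ , refl))
  rootSeq-avoidsSink (d ∧ᶠ e) (nd , ne , disjoint) σ
    with joinRoots-rootSeq (tree d) (tree e) σ
  ... | inj₁ σ′ = QAnd-avoidsSinkˡ (rootSeq-avoidsSink d nd σ′)
    (λ { refl → ta-edge d (rootSeq-head d σ′) })
    (rootSeq-address d e (λ j∈ j∈′ → disjoint (_ , x∈p∩q⁺ (j∈ , j∈′))) σ′)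
  ... | inj₂ σ′ = QAnd-avoidsSinkʳ (rootSeq-avoidsSink e ne σ′)
    (λ { refl → ta-edge e (rootSeq-head e σ′) })
    (rootSeq-address e d (λ j∈ j∈′ → disjoint (_ , x∈p∩q⁺ (j∈′ , j∈))) σ′)

  -- From the update to the action model

  module _ {φ} (d : DBI φ) {M : KripkeModel} {v : State M}
           (defined : UpdateDefined M v (U d) 𝟎) where
    open PointedUpdate M v (U d) 𝟎 defined

    -- Projection to events is a frame homomorphism, so clusters that meet in the update also meet
    -- in the action model.
    cluster-event : ∀ {x y} s → Cluster (KripkeModel.frame model) x s y →
                    Cluster (eventFrame (QE d)) (proj₂ (value x)) s (proj₂ (value y))
    cluster-event []      refl              = refl
    cluster-event (i ∷ s) (_ , (_ , q) , c) = _ , q , cluster-event s c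

theorem10 : (n : ℕ) → n > 1 → (Atom : Set) (p₀ : Atom) →
    let open EpistemicLogic n Atom p₀ in
    (φ : Formula) (d : DBI φ) → Normal d →
    (M : KripkeModel) (v : State M) →
    Σ[ defined ∈ UpdateDefined M v (U d) 𝟎 ]
    (let open PointedUpdate M v (U d) 𝟎 defined in
    WeaklyPrivatized d (KripkeModel.frame model) point)
theorem10 n _ Atom p₀ φ d nd M v = defined , λ σ s nsr s≢ → λ { _ (c , c′) →
    s≢ (sym (cluster-unique (QE-addressed d) (rootSeq-avoidsSink d nd (σ , refl))
         (rootSeq-nsr d nd (σ , refl)) nsr
         (cluster-event d defined (agSeq σ) c) (cluster-event d defined s c′))) }
  where
  open EpistemicLogic n Atom p₀
  open Addresses n Atom p₀
  defined : UpdateDefined M v (U d) 𝟎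
  -- The precondition of `𝟎` is `⊤ᶠ`, the negation of a contradiction.
  defined (p , ¬p) = ¬p p
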